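{- Let $S$ be a finite nonempty ground set, let $f,c:2^S\to\mathbb{R}_{\ge 0}$ and $\tau\le f(S)$ form an instance of Submodular Cost Submodular Cover (SCSC), and let $A^*$ be an optimal solution, i.e. $A^*$ minimizes $c(X)$ over all $X\subseteq S$ with $f(X)\ge\tau$. Let $\epsilon\ge 0$ and let $F:2^S\to\mathbb{R}_{\ge 0}$ be $\epsilon$-approximate to $f$. Suppose the greedy algorithm is run with input $F$, $c$, $\tau$ and returns the set $A$ (so that $F(A)\ge\tau$). Then $f(A)\ge\tau-\epsilon$. Moreover, if $\mu>4\epsilon c_{max}\rho/c_{min}$, then $$c(A)\le\frac{\rho}{1-\frac{4\epsilon c_{max}\rho}{c_{min}\mu}}\left(\ln\left(\frac{\alpha}{\beta}\right)+2\right)c(A^*).$$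
   Context: SCSC instance: $f,c:2^S\to\mathbb{R}_{\ge0}$ are monotone ($g(X)\le g(Y)$ for $X\subseteq Y$) and submodular ($g(X\cup\{x\})-g(X)\ge g(Y\cup\{x\})-g(Y)$ for $X\subseteq Y\subseteq S$, $x\notin Y$), with $f(\emptyset)=0$, and $c(X)=0$ if and only if $X=\emptyset$; $\tau\le f(S)$ is a real threshold. The problem is to minimize $c(X)$ over $X\subseteq S$ with $f(X)\ge\tau$. $F$ is $\epsilon$-approximate to $f$ if $|f(X)-F(X)|\le\epsilon$ for all $X\subseteq S$. ($F$ is not assumed monotone or submodular.) Notation: $g_\tau(X)=\min\{\tau,g(X)\}$; $\Delta g(X,x)=g(X\cup\{x\})-g(X)$; $c(x)=c(\{x\})$. Greedy algorithm with input $F,c,\tau$: start with $A=\emptyset$; while $F(A)<\tau$, choose $u\in\text{argmax}_{x\in S\setminus A}\Delta F_\tau(A,x)/c(x)$ (ties broken arbitrarily) and replace $A$ by $A\cup\{u\}$; when $F(A)\ge\tau$, return $A$. Parameters: $c_{min}=\min_{x\in S}c(x)$, $c_{max}=\max_{x\in S}c(x)$, $\alpha=\max_{x\in S}f(\{x\})$, and $\rho=\max_{\emptyset\ne X\subseteq S}\sum_{x\in X}c(x)/c(X)$ is the curvature of $c$. If the run has $k$ iterations of the while loop, $A_0=\emptyset$ and $A_i$ is the set $A$ at the end of iteration $i$ (so $A=A_k$). Then $\mu=\min\{f_\tau(A_i)-f_\tau(A_{i-1}):i\in\{1,\dots,k\}\}$ and $\beta=\min\{\Delta f_\tau(A_i,x):i\in\{0,\dots,k\},\,x\in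 S,\,\Delta f_\tau(A_i,x)>0\}$. If $k=0$, then $A=\emptyset$, $c(A)=0$, and the cost bound is regarded as holding trivially. -}

module Defs where

open import Algebra.Bundles using (CommutativeRing)
import Algebra.Construct.NaturalChoice.Max as Max
import Algebra.Construct.NaturalChoice.Min as Min
import Algebra.Definitions.RawMonoid as RawMonoidDefs
import Algebra.Properties.Ring as RingProperties
open import Data.Bool.Base using (if_then_else_)
open import Data.Fin.Base using (Fin; zero; suc; inject₁; fromℕ)
open import Data.Fin.Subset
  using (Subset; _∈_; _∉_; _⊆_; _∪_; ⁅_⁆; ⊤; ⊥; Nonempty)
open import Data.Fin.Subset.Properties using (_∈?_)
open import Data.Nat.Base using (ℕ; suc)
open import Data.Product.Base using (_×_; _,_; ∃; proj₁)
open import Data.Sum.Base using (inj₁; inj₂)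
open import Function.Bundles using (_⇔_)
open import Level using (_⊔_)
open import Relation.Binary.Bundles using (DecTotalOrder)
open import Relation.Binary.PropositionalEquality.Core using (_≡_)
import Relation.Binary.Properties.DecTotalOrder as DecTotalOrderProperties
import Relation.Binary.Reasoning.PartialOrder as PartialOrderReasoning
open import Relation.Binary.Structures using (IsDecTotalOrder)
open import Relation.Nullary.Decidable.Core using (does; yes; no)
open import Relation.Nullary.Negation.Core using (¬_)
open import Relation.Unary using (U)

-- The real numbers, given axiomatically as a Dedekind-complete ordered field
-- (unique up to isomorphism).  As the order is decidable, this is the real
-- line of classical mathematics.  The value of 0# ⁻¹ is left unspecified.

record RealField ℓ : Set (Level.suc ℓ) where
  infix 4 _≤_
  infix 8 _⁻¹

  field
    commutativeRing : CommutativeRing ℓ ℓ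

  open CommutativeRing commutativeRing public renaming (Carrier to ℝ; zero to *-zero)

  field
    _≤_             : ℝ → ℝ → Set ℓ
    isDecTotalOrder : IsDecTotalOrder _≈_ _≤_
    0≉1             : ¬ (0# ≈ 1#)
    _⁻¹             : ℝ → ℝ
    ⁻¹-cong         : ∀ {x y} → x ≈ y → x ⁻¹ ≈ y ⁻¹
    ⁻¹-inverseʳ     : ∀ {x} → ¬ (x ≈ 0#) → x * x ⁻¹ ≈ 1#
    +-monoˡ-≤       : ∀ z {x y} → x ≤ y → x + z ≤ y + z
    *-nonNeg        : ∀ {x y} → 0# ≤ x → 0# ≤ y → 0# ≤ x * y

  UpperBound : (ℝ → Set ℓ) → ℝ → Set ℓ
  UpperBound P b = ∀ x → P x → x ≤ b

  field
    supremum : ∀ (P : ℝ → Set ℓ) → ∃ P → ∃ (UpperBound P) →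
               ∃ λ s → UpperBound P s × (∀ b → UpperBound P b → s ≤ b)

  decTotalOrder : DecTotalOrder ℓ ℓ ℓ
  decTotalOrder = record { isDecTotalOrder = isDecTotalOrder }

  open IsDecTotalOrder isDecTotalOrder public
    using (_≤?_)
    renaming ( refl to ≤-refl; reflexive to ≤-reflexive; trans to ≤-trans
             ; antisym to ≤-antisym; total to ≤-total )

  open DecTotalOrderProperties decTotalOrder public using (_<_; ≰⇒>)
  open Min (DecTotalOrder.totalOrder decTotalOrder) public using (_⊓_)
  open RawMonoidDefs +-rawMonoid public using (sum)

  infixl 7 _/_
  infix 4 _≥_ _>_

  _/_ : ℝ → ℝ → ℝ
  x / y = x * y ⁻¹

  _≥_ _>_ : ℝ → ℝ → Set ℓ
  x ≥ y = y ≤ x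
  x > y = y < x

  ∣_∣ : ℝ → ℝ
  ∣ x ∣ = x ∨ - x
    where open Max (DecTotalOrder.totalOrder decTotalOrder) using () renaming (_⊔_ to _∨_)

  2# 4# : ℝ
  2# = 1# + 1#
  4# = 2# + 2#

module OrderedFieldProperties {ℓ} (R : RealField ℓ) where
  open RealField R
  open RingProperties ring using (-‿distribˡ-*; -‿distribʳ-*; -‿involutive)
  private
    open module ≤-Reasoning =
      PartialOrderReasoning (DecTotalOrder.poset decTotalOrder)

  +-monoʳ-≤ : ∀ z {x y} → x ≤ y → z + x ≤ z + y
  +-monoʳ-≤ z {x} {y} p = begin
    z + x  ≈⟨ +-comm z x ⟩
    x + z  ≤⟨ +-monoˡ-≤ z p ⟩
    y + z  ≈⟨ +-comm y z ⟩
    z + y  ∎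

  sub-nonNeg : ∀ {x y} → x ≤ y → 0# ≤ y - x
  sub-nonNeg {x} {y} p = begin
    0#     ≈⟨ sym (-‿inverseʳ x) ⟩
    x - x  ≤⟨ +-monoˡ-≤ (- x) p ⟩
    y - x  ∎

  sub-nonNeg⁻¹ : ∀ {x y} → 0# ≤ y - x → x ≤ y
  sub-nonNeg⁻¹ {x} {y} p = begin
    x            ≈⟨ sym (+-identityˡ x) ⟩
    0# + x       ≤⟨ +-monoˡ-≤ x p ⟩
    y - x + x    ≈⟨ +-assoc y (- x) x ⟩
    y + (- x + x) ≈⟨ +-congˡ (-‿inverseˡ x) ⟩
    y + 0#       ≈⟨ +-identityʳ y ⟩
    y            ∎

  *-monoˡ-≤ : ∀ {z x y} → 0# ≤ z → x ≤ y → z * x ≤ z * y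
  *-monoˡ-≤ {z} {x} {y} 0≤z p = sub-nonNeg⁻¹ (begin
    0#               ≤⟨ *-nonNeg 0≤z (sub-nonNeg p) ⟩
    z * (y - x)      ≈⟨ distribˡ z y (- x) ⟩
    z * y + z * - x  ≈⟨ +-congˡ (sym (-‿distribʳ-* z x)) ⟩
    z * y - z * x    ∎)

  *-monoʳ-≤ : ∀ {z x y} → 0# ≤ z → x ≤ y → x * z ≤ y * z
  *-monoʳ-≤ {z} {x} {y} 0≤z p = begin
    x * z  ≈⟨ *-comm x z ⟩
    z * x  ≤⟨ *-monoˡ-≤ 0≤z p ⟩
    z * y  ≈⟨ *-comm z y ⟩
    y * z  ∎

  telescope : ∀ M a t b → M * (t - a) + M * (b - t) ≈ M * (b - a)
  telescope M a t b = trans (sym (distribˡ M (t - a) (b - t))) (*-congˡ (begin-equality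
    (t - a) + (b - t)      ≈⟨ +-comm (t - a) (b - t) ⟩
    (b - t) + (t - a)      ≈⟨ +-assoc b (- t) (t - a) ⟩
    b + (- t + (t - a))    ≈⟨ +-congˡ (sym (+-assoc (- t) t (- a))) ⟩
    b + ((- t + t) - a)    ≈⟨ +-congˡ (+-congʳ (-‿inverseˡ t)) ⟩
    b + (0# - a)           ≈⟨ +-congˡ (+-identityˡ (- a)) ⟩
    b - a                  ∎))

  <-≤-trans : ∀ {x y z} → x < y → y ≤ z → x < z
  <-≤-trans (x≤y , x≉y) y≤z =
    ≤-trans x≤y y≤z , λ x≈z → x≉y (≤-antisym x≤y (≤-trans y≤z (≤-reflexive (sym x≈z))))

  inverse : ∀ {x} → 0# < x → x * x ⁻¹ ≈ 1#
  inverse (_ , 0≉x) = ⁻¹-inverseʳ (λ x≈0 → 0≉x (sym x≈0))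

  square-nonNeg : ∀ x → 0# ≤ x * x
  square-nonNeg x with ≤-total 0# x
  ... | inj₁ 0≤x = *-nonNeg 0≤x 0≤x
  ... | inj₂ x≤0 = begin
    0#                 ≤⟨ *-nonNeg 0≤-x 0≤-x ⟩
    - x * - x          ≈⟨ sym (-‿distribʳ-* (- x) x) ⟩
    - (- x * x)        ≈⟨ -‿cong (sym (-‿distribˡ-* x x)) ⟩
    - - (x * x)        ≈⟨ -‿involutive (x * x) ⟩
    x * x              ∎
    where
    0≤-x : 0# ≤ - x
    0≤-x = ≤-trans (sub-nonNeg x≤0) (≤-reflexive (+-identityˡ (- x)))

  ⁻¹-nonNeg : ∀ {x} → 0# < x → 0# ≤ x ⁻¹
  ⁻¹-nonNeg {x} 0<x = begin
    0#                   ≤⟨ *-nonNeg (proj₁ 0<x) (square-nonNeg (x ⁻¹)) ⟩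
    x * (x ⁻¹ * x ⁻¹)    ≈⟨ sym (*-assoc x (x ⁻¹) (x ⁻¹)) ⟩
    x * x ⁻¹ * x ⁻¹      ≈⟨ *-congʳ (inverse 0<x) ⟩
    1# * x ⁻¹            ≈⟨ *-identityˡ (x ⁻¹) ⟩
    x ⁻¹                 ∎

  ⁻¹-antitone : ∀ {x y} → 0# < x → x ≤ y → y ⁻¹ ≤ x ⁻¹
  ⁻¹-antitone {x} {y} 0<x x≤y = begin
    y ⁻¹                 ≈⟨ sym (*-identityʳ (y ⁻¹)) ⟩
    y ⁻¹ * 1#            ≈⟨ *-congˡ (sym (inverse 0<x)) ⟩
    y ⁻¹ * (x * x ⁻¹)    ≤⟨ *-monoˡ-≤ (⁻¹-nonNeg 0<y) (*-monoʳ-≤ (⁻¹-nonNeg 0<x) x≤y) ⟩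
    y ⁻¹ * (y * x ⁻¹)    ≈⟨ sym (*-assoc (y ⁻¹) y (x ⁻¹)) ⟩
    y ⁻¹ * y * x ⁻¹      ≈⟨ *-congʳ (trans (*-comm (y ⁻¹) y) (inverse 0<y)) ⟩
    1# * x ⁻¹            ≈⟨ *-identityˡ (x ⁻¹) ⟩
    x ⁻¹                 ∎
    where
    0<y : 0# < y
    0<y = <-≤-trans 0<x x≤y

  0≤1 : 0# ≤ 1#
  0≤1 = ≤-trans (square-nonNeg 1#) (≤-reflexive (*-identityˡ 1#))

module Logarithm {ℓ} (R : RealField ℓ) where
  open RealField R
  open OrderedFieldProperties R
  private
    open module ≤-Reasoning =
      PartialOrderReasoning (DecTotalOrder.poset decTotalOrder)

  -- LowerSum g a b s: s is the integral over [a , b] of some step function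
  -- lying below g.

  data LowerSum (g : ℝ → ℝ) : ℝ → ℝ → ℝ → Set ℓ where
    empty : ∀ {a b} → a ≈ b → LowerSum g a b 0#
    step : ∀ {a b t m s} → a ≤ t → (∀ u → a ≤ u → u ≤ t → m ≤ g u) →
           LowerSum g t b s → LowerSum g a b (m * (t - a) + s)

  LowerSum-bounded : ∀ {g M a b s} → (∀ u → a ≤ u → g u ≤ M) →
                     LowerSum g a b s → s ≤ M * (b - a)
  LowerSum-bounded {M = M} {a} {b} g≤M (empty a≈b) = ≤-reflexive (begin-equality
    0#           ≈⟨ sym (zeroʳ M) ⟩
    M * 0#       ≈⟨ *-congˡ (sym (-‿inverseʳ a)) ⟩
    M * (a - a)  ≈⟨ *-congˡ (+-congʳ a≈b) ⟩
    M * (b - a)  ∎)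
  LowerSum-bounded {M = M} {a} {b} g≤M (step {t = t} {m} {s} a≤t m≤g S) = begin
    m * (t - a) + s                ≤⟨ +-monoˡ-≤ s (*-monoʳ-≤ (sub-nonNeg a≤t)
                                       (≤-trans (m≤g a ≤-refl a≤t) (g≤M a ≤-refl))) ⟩
    M * (t - a) + s                ≤⟨ +-monoʳ-≤ (M * (t - a))
                                       (LowerSum-bounded (λ u t≤u → g≤M u (≤-trans a≤t t≤u)) S) ⟩
    M * (t - a) + M * (b - t)      ≈⟨ telescope M a t b ⟩
    M * (b - a)                    ∎

  -- The lower Darboux integral of 1/t over [a , b]; as 1/t is continuous there,
  -- it is the integral.

  ∫⁻¹-supremum : ∀ a b → 0# < a → a ≤ b →
                 ∃ λ s → UpperBound (LowerSum _⁻¹ a b) s ×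
                         (∀ c → UpperBound (LowerSum _⁻¹ a b) c → s ≤ c)
  ∫⁻¹-supremum a b 0<a a≤b = supremum (LowerSum _⁻¹ a b)
    ( _
    , step {m = b ⁻¹} a≤b (λ u a≤u u≤b → ⁻¹-antitone (<-≤-trans 0<a a≤u) u≤b)
        (empty refl))
    ( a ⁻¹ * (b - a)
    , λ s → LowerSum-bounded (λ u a≤u → ⁻¹-antitone 0<a a≤u))

  ∫⁻¹ : ∀ a b → 0# < a → a ≤ b → ℝ
  ∫⁻¹ a b 0<a a≤b = proj₁ (∫⁻¹-supremum a b 0<a a≤b)

  -- ln x = ∫₁ˣ dt/t, with the junk value 0# for x ≤ 0#.

  ln : ℝ → ℝ
  ln x with x ≤? 0# | ≤-total 1# x
  ... | yes _  | _        = 0#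
  ... | no _   | inj₁ 1≤x = ∫⁻¹ 1# x (0≤1 , 0≉1) 1≤x
  ... | no x≰0 | inj₂ x≤1 = - ∫⁻¹ x 1# (≰⇒> x≰0) x≤1

module Extrema {ℓ} (R : RealField ℓ) where
  open RealField R

  IsMax IsMin : ∀ {i p} {I : Set i} → (I → Set p) → (I → ℝ) → ℝ → Set (i ⊔ p ⊔ ℓ)
  IsMax P v m = (∃ λ i → P i × v i ≈ m) × (∀ i → P i → v i ≤ m)
  IsMin P v m = (∃ λ i → P i × v i ≈ m) × (∀ i → P i → m ≤ v i)

module Cover {ℓ} (R : RealField ℓ) {n : ℕ} where
  open RealField R
  open Extrema R

  SetFunction : Set ℓ
  SetFunction = Subset n → ℝ

  NonNegative Monotone Submodular : SetFunction → Set ℓ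
  NonNegative g = ∀ X → 0# ≤ g X
  Monotone g = ∀ {X Y} → X ⊆ Y → g X ≤ g Y

  Δ : SetFunction → Subset n → Fin n → ℝ
  Δ g X x = g (X ∪ ⁅ x ⁆) - g X

  Submodular g = ∀ {X Y x} → X ⊆ Y → x ∉ Y → Δ g X x ≥ Δ g Y x

  truncate : ℝ → SetFunction → SetFunction
  truncate τ g X = τ ⊓ g X

  record IsSCSC (f c : SetFunction) (τ : ℝ) : Set ℓ where
    field
      f-nonNegative : NonNegative f
      f-monotone    : Monotone f
      f-submodular  : Submodular f
      f-∅           : f ⊥ ≈ 0#
      c-nonNegative : NonNegative c
      c-monotone    : Monotone c
      c-submodular  : Submodular c
      c-zero        : ∀ X → c X ≈ 0# ⇔ X ≡ ⊥
      τ≤f[S]        : τ ≤ f ⊤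

  IsOptimal : (f c : SetFunction) → ℝ → Subset n → Set ℓ
  IsOptimal f c τ A* = f A* ≥ τ × (∀ X → f X ≥ τ → c A* ≤ c X)

  IsApproximate : ℝ → (f F : SetFunction) → Set ℓ
  IsApproximate ε f F = ∀ X → ∣ f X - F X ∣ ≤ ε

  -- A complete (terminating) run of the greedy algorithm with k iterations;
  -- A i is the set held after i iterations, u i the element added in
  -- iteration i + 1.

  record GreedyRun (F c : SetFunction) (τ : ℝ) (k : ℕ) : Set ℓ where
    field
      A      : Fin (suc k) → Subset n
      u      : Fin k → Fin n
      start  : A zero ≡ ⊥
      guard  : ∀ i → F (A (inject₁ i)) < τ
      fresh  : ∀ i → u i ∉ A (inject₁ i)
      argmax : ∀ i x → x ∉ A (inject₁ i) →
               Δ (truncate τ F) (A (inject₁ i)) x / c ⁅ x ⁆ ≤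
               Δ (truncate τ F) (A (inject₁ i)) (u i) / c ⁅ u i ⁆
      update : ∀ i → A (suc i) ≡ A (inject₁ i) ∪ ⁅ u i ⁆
      finish : F (A (fromℕ k)) ≥ τ

    output : Subset n
    output = A (fromℕ k)

  sumOver : (Fin n → ℝ) → Subset n → ℝ
  sumOver w X = sum (λ x → if does (x ∈? X) then w x else 0#)

  IsMaxSingleton IsMinSingleton : SetFunction → ℝ → Set ℓ
  IsMaxSingleton g = IsMax {I = Fin n} U (λ x → g ⁅ x ⁆)
  IsMinSingleton g = IsMin {I = Fin n} U (λ x → g ⁅ x ⁆)

  IsCurvature : SetFunction → ℝ → Set ℓ
  IsCurvature c = IsMax Nonempty (λ X → sumOver (λ x → c ⁅ x ⁆) X / c X)

  module _ {F c : SetFunction} {τ : ℝ} {k : ℕ} (run : GreedyRun F c τ k) where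
    open GreedyRun run

    -- No real satisfies this when k = 0, the minimum being over the empty set.

    IsMinGain : SetFunction → ℝ → Set ℓ
    IsMinGain f = IsMin {I = Fin k} U
      (λ i → truncate τ f (A (suc i)) - truncate τ f (A (inject₁ i)))

    IsMinPositiveMarginal : SetFunction → ℝ → Set ℓ
    IsMinPositiveMarginal f = IsMin {I = Fin (suc k) × Fin n}
      (λ (i , x) → Δ (truncate τ f) (A i) x > 0#)
      (λ (i , x) → Δ (truncate τ f) (A i) x)

{-# OPTIONS --safe #-}

-- Truncation at τ preserves diminishing returns, so the marginals hᵢ(x) of fτ
-- at Aᵢ decrease in i and the residual rᵢ = τ - fτ(Aᵢ) is at most Σ hᵢ(x) over
-- x ∈ A*.  The oracle error shifts the greedy ratios by at most 4ε / cmin, so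
-- the prices qᵢ = c(uᵢ) / gainᵢ satisfy qᵢ hᵢ(x) ≤ K c(x) for K = 1 + η and
-- η = 4ε cmax / (cmin μ).  The prices need not increase, but their running
-- maxima Qᵢ satisfy the same inequality.  Summation by parts bounds
-- c(A) ≤ Σ qᵢ (rᵢ - rᵢ₊₁) by the charges Σ (Qᵢ₊₁ - Qᵢ) hᵢ(x) of all x ∈ A*, and
-- each charge by K c(x) (ln (α / β) + 1).  Finally K ≤ 1 / (1 - ρη), as ρ ≥ 1.

module Submission where

open import Defs
open import Data.Nat.Base using (ℕ; NonZero)
open import Data.Fin.Subset using (Subset)
open import Data.Product.Base using (_×_)
open import Algebra.Bundles using (CommutativeRing)
import Algebra.Construct.NaturalChoice.Max as Max
import Algebra.Construct.NaturalChoice.Min as Min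
import Algebra.Properties.Ring as RingProperties
import Algebra.Properties.Semiring.Mult.TCOptimised as Multiples
import Algebra.Properties.Semiring.Sum as Sum
import Algebra.Solver.Ring as RingSolver
open import Algebra.Solver.Ring.AlmostCommutativeRing
  using (fromCommutativeRing; _-Raw-AlmostCommutative⟶_)
open import Data.Bool.Base using (Bool; true; false; if_then_else_)
open import Data.Empty using (⊥-elim)
open import Data.Fin.Base using (Fin; zero; suc; inject₁; fromℕ)
open import Data.Fin.Induction using (<-weakInduction)
open import Data.Fin.Subset using (_∈_; _⊆_; _∪_; ⁅_⁆; ⊥; Nonempty)
open import Data.Fin.Subset.Properties
  using ( _∈?_; p⊆p∪q; q⊆p∪q; x∈p∪q⁻; x∈⁅x⁆; x∈⁅y⁆⇒x≡y; ∉⊥; ⊥⊆; nonempty?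
        ; Empty-unique; ∪-identityˡ)
open import Data.Integer.Base as ℤ using (ℤ; +_; -[1+_])
import Data.Integer.Properties as ℤₚ
open import Data.Maybe.Base using (map)
open import Data.Nat.Base as ℕ using (zero; suc)
open import Data.Product.Base using (_,_; ∃; proj₁; proj₂)
import Data.Sign.Base as Sign
open import Data.Sum.Base using (_⊎_; inj₁; inj₂)
open import Function.Base using (_∘_; id)
open import Function.Bundles using (Equivalence)
open import Relation.Binary.Bundles using (DecTotalOrder)
open import Relation.Binary.PropositionalEquality.Core as ≡ using (_≡_)
import Relation.Binary.Reasoning.PartialOrder as PartialOrderReasoning
import Relation.Binary.Reasoning.Setoid as SetoidReasoning
open import Relation.Nullary.Decidable using (yes; no; does; dec-true; dec⇒maybe)
open import Relation.Nullary.Negation.Core using (¬_)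

-- Ring solver over the integers.

-- Integer coefficients let the solver cancel x - x, which is impossible with
-- coefficients in an abstract ring.

module IntegerCoefficients {r₁ r₂} (R : CommutativeRing r₁ r₂) where
  open CommutativeRing R
  open RingProperties ring using (-‿distribˡ-*; -‿distribʳ-*; -‿involutive; -‿+-comm; -0#≈0#)
  open Multiples semiring using (×-homo-+; ×1-homo-*) renaming (_×_ to _·_)
  open SetoidReasoning setoid

  -- The canonical homomorphism from the integers. With these multiples `con (+ 1)` and `con (+ 2)`
  -- unfold to `1#` and `1# + 1#`, so solver equations match the constants of the field
  -- definitionally.
  ⟦_⟧ : ℤ → Carrier
  ⟦ + n ⟧      = n · 1#
  ⟦ -[1+ n ] ⟧ = - (suc n · 1#)

  suc-× : ∀ n → suc n · 1# ≈ 1# + n · 1#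
  suc-× = ×-homo-+ 1# 1

  ⊖-homo : ∀ m n → ⟦ m ℤ.⊖ n ⟧ ≈ m · 1# - n · 1#
  ⊖-homo zero    zero    = sym (-‿inverseʳ 0#)
  ⊖-homo zero    (suc n) = sym (+-identityˡ _)
  ⊖-homo (suc m) zero    = sym (trans (+-congˡ -0#≈0#) (+-identityʳ _))
  ⊖-homo (suc m) (suc n) = begin
    ⟦ suc m ℤ.⊖ suc n ⟧                  ≡⟨ ≡.cong ⟦_⟧ (ℤₚ.[1+m]⊖[1+n]≡m⊖n m n) ⟩
    ⟦ m ℤ.⊖ n ⟧                          ≈⟨ ⊖-homo m n ⟩
    m · 1# - n · 1#                      ≈⟨ +-congˡ (+-identityˡ _) ⟨
    m · 1# + (0# - n · 1#)               ≈⟨ +-congˡ (+-congʳ (-‿inverseʳ 1#)) ⟨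
    m · 1# + (1# - 1# - n · 1#)          ≈⟨ +-congˡ (+-assoc _ _ _) ⟩
    m · 1# + (1# + (- 1# - n · 1#))      ≈⟨ +-assoc _ _ _ ⟨
    m · 1# + 1# + (- 1# - n · 1#)        ≈⟨ +-cong (+-comm _ _) (-‿+-comm _ _) ⟩
    1# + m · 1# - (1# + n · 1#)          ≈⟨ +-cong (suc-× m) (-‿cong (suc-× n)) ⟨
    suc m · 1# - suc n · 1#              ∎

  +-homo : ∀ i j → ⟦ i ℤ.+ j ⟧ ≈ ⟦ i ⟧ + ⟦ j ⟧
  +-homo (+ m)    (+ n)    = ×-homo-+ 1# m n
  +-homo (+ m)    -[1+ n ] = ⊖-homo m (suc n)
  +-homo -[1+ m ] (+ n)    = trans (⊖-homo n (suc m)) (+-comm _ _)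
  +-homo -[1+ m ] -[1+ n ] = begin
    - (suc (suc (m ℕ.+ n)) · 1#)       ≈⟨ -‿cong (suc-× (suc (m ℕ.+ n))) ⟩
    - (1# + (suc m ℕ.+ n) · 1#)        ≈⟨ -‿cong (+-congˡ (×-homo-+ 1# (suc m) n)) ⟩
    - (1# + (suc m · 1# + n · 1#))     ≈⟨ -‿cong (+-congˡ (+-comm _ _)) ⟩
    - (1# + (n · 1# + suc m · 1#))     ≈⟨ -‿cong (+-assoc _ _ _) ⟨
    - (1# + n · 1# + suc m · 1#)       ≈⟨ -‿cong (+-congʳ (suc-× n)) ⟨
    - (suc n · 1# + suc m · 1#)        ≈⟨ -‿cong (+-comm _ _) ⟩
    - (suc m · 1# + suc n · 1#)        ≈⟨ -‿+-comm _ _ ⟨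
    - (suc m · 1#) - suc n · 1#        ∎

  +◃-homo : ∀ n → ⟦ Sign.+ ℤ.◃ n ⟧ ≈ n · 1#
  +◃-homo zero    = refl
  +◃-homo (suc n) = refl

  -◃-homo : ∀ n → ⟦ Sign.- ℤ.◃ n ⟧ ≈ - (n · 1#)
  -◃-homo zero    = sym -0#≈0#
  -◃-homo (suc n) = refl

  *-homo : ∀ i j → ⟦ i ℤ.* j ⟧ ≈ ⟦ i ⟧ * ⟦ j ⟧
  *-homo (+ m)    (+ n)    = trans (+◃-homo (m ℕ.* n)) (×1-homo-* m n)
  *-homo (+ m)    -[1+ n ] = begin
    ⟦ Sign.- ℤ.◃ m ℕ.* suc n ⟧      ≈⟨ -◃-homo (m ℕ.* suc n) ⟩
    - ((m ℕ.* suc n) · 1#)          ≈⟨ -‿cong (×1-homo-* m (suc n)) ⟩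
    - (m · 1# * (suc n · 1#))       ≈⟨ -‿distribʳ-* _ _ ⟩
    m · 1# * - (suc n · 1#)         ∎
  *-homo -[1+ m ] (+ n)    = begin
    ⟦ Sign.- ℤ.◃ suc m ℕ.* n ⟧      ≈⟨ -◃-homo (suc m ℕ.* n) ⟩
    - ((suc m ℕ.* n) · 1#)          ≈⟨ -‿cong (×1-homo-* (suc m) n) ⟩
    - (suc m · 1# * (n · 1#))       ≈⟨ -‿distribˡ-* _ _ ⟩
    - (suc m · 1#) * (n · 1#)       ∎
  *-homo -[1+ m ] -[1+ n ] = begin
    (suc m ℕ.* suc n) · 1#               ≈⟨ ×1-homo-* (suc m) (suc n) ⟩
    suc m · 1# * (suc n · 1#)            ≈⟨ -‿involutive _ ⟨
    - - (suc m · 1# * (suc n · 1#))      ≈⟨ -‿cong (-‿distribˡ-* _ _) ⟩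
    - (- (suc m · 1#) * (suc n · 1#))    ≈⟨ -‿distribʳ-* _ _ ⟩
    - (suc m · 1#) * - (suc n · 1#)      ∎

  -‿homo : ∀ i → ⟦ ℤ.- i ⟧ ≈ - ⟦ i ⟧
  -‿homo (+ zero)  = sym -0#≈0#
  -‿homo (+ suc n) = refl
  -‿homo -[1+ n ]  = sym (-‿involutive _)

  morphism : ℤ.+-*-rawRing -Raw-AlmostCommutative⟶ fromCommutativeRing R
  morphism = record
    { ⟦_⟧    = ⟦_⟧
    ; +-homo = +-homo
    ; *-homo = *-homo
    ; -‿homo = -‿homo
    ; 0-homo = refl
    ; 1-homo = refl
    }

  open RingSolver ℤ.+-*-rawRing (fromCommutativeRing R) morphism
    (λ i j → map (λ i≡j → reflexive (≡.cong ⟦_⟧ i≡j)) (dec⇒maybe (i ℤₚ.≟ j))) public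
    using (solve; _:=_; _:+_; _:*_; :-_; _:-_; con)

-- Ordered field arithmetic, absolute values and truncation by a minimum.

module OrderedFieldLemmas {ℓ} (R : RealField ℓ) where
  open RealField R
  open OrderedFieldProperties R
  open IntegerCoefficients commutativeRing using (solve; _:=_; _:+_; _:*_; :-_; _:-_; con)
  open PartialOrderReasoning (DecTotalOrder.poset decTotalOrder)
  open Min (DecTotalOrder.totalOrder decTotalOrder)
    using (x⊓y≤x; x⊓y≤y; x≤y⇒x⊓y≈x; x≤y⇒y⊓x≈x; ⊓-monoʳ-≤; ⊓-sel)
  open Max (DecTotalOrder.totalOrder decTotalOrder)
    using (x≤x⊔y; x≤y⊔x; ⊔-sel) renaming (_⊔_ to _∨_)

  -- Turns an inequality into a certificate: `d` is assembled from known nonnegative slacks, and the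
  -- identity `y - x ≈ d` is left to the ring solver.
  ≤-from-difference : ∀ {x y d} → 0# ≤ d → y - x ≈ d → x ≤ y
  ≤-from-difference 0≤d y-x≈d = sub-nonNeg⁻¹ (≤-trans 0≤d (≤-reflexive (sym y-x≈d)))

  +-mono-≤ : ∀ {x y u v} → x ≤ y → u ≤ v → x + u ≤ y + v
  +-mono-≤ {y = y} {u} x≤y u≤v = ≤-trans (+-monoˡ-≤ u x≤y) (+-monoʳ-≤ y u≤v)

  +-nonNeg : ∀ {x y} → 0# ≤ x → 0# ≤ y → 0# ≤ x + y
  +-nonNeg 0≤x 0≤y = ≤-trans (≤-reflexive (sym (+-identityˡ 0#))) (+-mono-≤ 0≤x 0≤y)

  ≤-+⇒-≤ : ∀ {x y z} → x ≤ y + z → x - z ≤ y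
  ≤-+⇒-≤ {x} {y} {z} x≤y+z = ≤-from-difference (sub-nonNeg x≤y+z)
    (solve 3 (λ x y z → y :- (x :- z) := y :+ z :- x) refl x y z)

  ≤-<-trans : ∀ {x y z} → x ≤ y → y < z → x < z
  ≤-<-trans x≤y (y≤z , y≉z) =
    ≤-trans x≤y y≤z , λ x≈z → y≉z (≤-antisym y≤z (≤-trans (≤-reflexive (sym x≈z)) x≤y))

  0<1 : 0# < 1#
  0<1 = 0≤1 , 0≉1

  ≰0 : ∀ {x} → 0# < x → ¬ (x ≤ 0#)
  ≰0 (0≤x , 0≉x) x≤0 = 0≉x (≤-antisym 0≤x x≤0)

  *-pos : ∀ {x y} → 0# < x → 0# < y → 0# < x * y
  *-pos {x} {y} 0<x 0<y = *-nonNeg (proj₁ 0<x) (proj₁ 0<y) , λ 0≈xy → proj₂ 0<y (begin-equality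
    0#              ≈⟨ zeroˡ (x ⁻¹) ⟨
    0# * x ⁻¹       ≈⟨ *-congʳ 0≈xy ⟩
    x * y * x ⁻¹    ≈⟨ solve 3 (λ x y i → x :* y :* i := x :* i :* y) refl x y (x ⁻¹) ⟩
    x * x ⁻¹ * y    ≈⟨ *-congʳ (inverse 0<x) ⟩
    1# * y          ≈⟨ *-identityˡ y ⟩
    y               ∎)

  /-cancelʳ : ∀ {y} x → 0# < y → x / y * y ≈ x
  /-cancelʳ {y} x 0<y = begin-equality
    x * y ⁻¹ * y    ≈⟨ solve 3 (λ x y i → x :* i :* y := x :* (y :* i)) refl x y (y ⁻¹) ⟩
    x * (y * y ⁻¹)  ≈⟨ *-congˡ (inverse 0<y) ⟩
    x * 1#          ≈⟨ *-identityʳ x ⟩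
    x               ∎

  /-monoˡ-≤ : ∀ {x y z} → 0# < z → x ≤ y → x / z ≤ y / z
  /-monoˡ-≤ 0<z = *-monoʳ-≤ (⁻¹-nonNeg 0<z)

  /≤⇒≤* : ∀ {x y z} → 0# < y → x / y ≤ z → x ≤ z * y
  /≤⇒≤* {x} {y} {z} 0<y x/y≤z = begin
    x          ≈⟨ /-cancelʳ x 0<y ⟨
    x / y * y  ≤⟨ *-monoʳ-≤ (proj₁ 0<y) x/y≤z ⟩
    z * y      ∎

  ≤*⇒/≤ : ∀ {x y z} → 0# < y → x ≤ z * y → x / y ≤ z
  ≤*⇒/≤ {x} {y} {z} 0<y x≤zy = begin
    x * y ⁻¹        ≤⟨ /-monoˡ-≤ 0<y x≤zy ⟩
    z * y * y ⁻¹    ≈⟨ *-assoc z y (y ⁻¹) ⟩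
    z * (y * y ⁻¹)  ≈⟨ *-congˡ (inverse 0<y) ⟩
    z * 1#          ≈⟨ *-identityʳ z ⟩
    z               ∎

  *≤⇒≤/ : ∀ {x y z} → 0# < y → z * y ≤ x → z ≤ x / y
  *≤⇒≤/ {x} {y} {z} 0<y zy≤x = begin
    z               ≈⟨ *-identityʳ z ⟨
    z * 1#          ≈⟨ *-congˡ (inverse 0<y) ⟨
    z * (y * y ⁻¹)  ≈⟨ *-assoc z y (y ⁻¹) ⟨
    z * y * y ⁻¹    ≤⟨ /-monoˡ-≤ 0<y zy≤x ⟩
    x * y ⁻¹        ∎

  1≤/ : ∀ {x y} → 0# < y → y ≤ x → 1# ≤ x / y
  1≤/ {y = y} 0<y y≤x = *≤⇒≤/ 0<y (≤-trans (≤-reflexive (*-identityˡ y)) y≤x)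

  cross-multiply : ∀ {a b y z} → 0# < y → 0# < z → a / y ≤ b / z → a * z ≤ b * y
  cross-multiply {a} {b} {y} {z} 0<y 0<z p = begin
    a * z            ≤⟨ *-monoʳ-≤ (proj₁ 0<z) (/≤⇒≤* 0<y p) ⟩
    b / z * y * z    ≈⟨ solve 4 (λ b i y z → b :* i :* y :* z := b :* i :* z :* y) refl b (z ⁻¹) y z ⟩
    b / z * z * y    ≈⟨ *-congʳ (/-cancelʳ b 0<z) ⟩
    b * y            ∎

  x≤∣x∣ : ∀ x → x ≤ ∣ x ∣
  x≤∣x∣ x = x≤x⊔y x (- x)

  -x≤∣x∣ : ∀ x → - x ≤ ∣ x ∣
  -x≤∣x∣ x = x≤y⊔x x (- x)

  ∣-∣≤⇒≤+ : ∀ {x y e} → ∣ x - y ∣ ≤ e → x ≤ y + e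
  ∣-∣≤⇒≤+ {x} {y} {e} p = ≤-from-difference (sub-nonNeg (≤-trans (x≤∣x∣ (x - y)) p))
    (solve 3 (λ x y e → y :+ e :- x := e :- (x :- y)) refl x y e)

  ∣-∣≤⇒≥+ : ∀ {x y e} → ∣ x - y ∣ ≤ e → y ≤ x + e
  ∣-∣≤⇒≥+ {x} {y} {e} p = ≤-from-difference (sub-nonNeg (≤-trans (-x≤∣x∣ (x - y)) p))
    (solve 3 (λ x y e → x :+ e :- y := e :- :- (x :- y)) refl x y e)

  -- Each of the two evaluations in a difference contributes one error `e`; this is the source of
  -- the `2ε` in comparisons of marginals.
  difference-shift : ∀ {a a′ b b′ e} → a′ ≤ b′ + e → b ≤ a + e → a′ - a ≤ b′ - b + 2# * e
  difference-shift {a} {a′} {b} {b′} {e} p q = ≤-from-difference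
    (+-nonNeg (sub-nonNeg p) (sub-nonNeg q))
    (solve 5 (λ a a′ b b′ e → b′ :- b :+ con (+ 2) :* e :- (a′ :- a)
                           := b′ :+ e :- a′ :+ (a :+ e :- b))
      refl a a′ b b′ e)

  -- The maximum is one of its two arguments, so a bound on both products passes to it whatever the
  -- sign of `y`. This matters because marginals `h` are multiplied by running maxima of prices.
  max-≤ : ∀ a b → ∃ λ m → a ≤ m × b ≤ m × (∀ {y c} → a * y ≤ c → b * y ≤ c → m * y ≤ c)
  max-≤ a b = a ∨ b , x≤x⊔y a b , x≤y⊔x a b , bound
    where
    bound : ∀ {y c} → a * y ≤ c → b * y ≤ c → (a ∨ b) * y ≤ c
    bound ay≤c by≤c with ⊔-sel a b
    ... | inj₁ m≈a = ≤-trans (≤-reflexive (*-congʳ m≈a)) ay≤c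
    ... | inj₂ m≈b = ≤-trans (≤-reflexive (*-congʳ m≈b)) by≤c

  τ⊓-shift : ∀ {τ e x y} → 0# ≤ e → x ≤ y + e → τ ⊓ x ≤ τ ⊓ y + e
  τ⊓-shift {τ} {e} {x} {y} 0≤e x≤y+e with ⊓-sel τ y
  ... | inj₁ ≈τ = begin
    τ ⊓ x      ≤⟨ x⊓y≤x τ x ⟩
    τ          ≈⟨ +-identityʳ τ ⟨
    τ + 0#     ≤⟨ +-mono-≤ (≤-reflexive (sym ≈τ)) 0≤e ⟩
    τ ⊓ y + e  ∎
  ... | inj₂ ≈y = begin
    τ ⊓ x      ≤⟨ x⊓y≤y τ x ⟩
    x          ≤⟨ x≤y+e ⟩
    y + e      ≈⟨ +-congʳ ≈y ⟨
    τ ⊓ y + e  ∎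

  -- Rearranged without subtraction, so that minima on either side can be estimated by monotonicity
  -- of addition.
  difference-exchange : ∀ {a a′ b b′} → b′ + a ≤ a′ + b → b′ - b ≤ a′ - a
  difference-exchange {a} {a′} {b} {b′} p = ≤-from-difference (sub-nonNeg p)
    (solve 4 (λ a a′ b b′ → a′ :- a :- (b′ :- b) := a′ :+ b :- (b′ :+ a)) refl a a′ b b′)

  difference-exchange⁻¹ : ∀ {a a′ b b′} → b′ - b ≤ a′ - a → b′ + a ≤ a′ + b
  difference-exchange⁻¹ {a} {a′} {b} {b′} p = ≤-from-difference (sub-nonNeg p)
    (solve 4 (λ a a′ b b′ → a′ :+ b :- (b′ :+ a) := a′ :- a :- (b′ :- b)) refl a a′ b b′)

  ⊓-difference-≤ : ∀ {τ a a′} → a ≤ a′ → τ ⊓ a′ - τ ⊓ a ≤ a′ - a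
  ⊓-difference-≤ {τ} {a} {a′} a≤a′ = difference-exchange (lemma (≤-total τ a))
    where
    lemma : τ ≤ a ⊎ a ≤ τ → τ ⊓ a′ + a ≤ a′ + τ ⊓ a
    lemma (inj₁ τ≤a) = begin
      τ ⊓ a′ + a  ≤⟨ +-mono-≤ (x⊓y≤x τ a′) a≤a′ ⟩
      τ + a′      ≈⟨ +-comm τ a′ ⟩
      a′ + τ      ≈⟨ +-congˡ (x≤y⇒x⊓y≈x τ≤a) ⟨
      a′ + τ ⊓ a  ∎
    lemma (inj₂ a≤τ) = +-mono-≤ (x⊓y≤y τ a′) (≤-reflexive (sym (x≤y⇒y⊓x≈x a≤τ)))

  -- The map `τ ⊓_` is nondecreasing and concave. If `τ ≤ b`, the left increment is at most zero and
  -- the right one is nonnegative; if `τ ≤ a′`, the endpoints compare separately; otherwise the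
  -- three values `a`, `a′`, `b` are not truncated.
  ⊓-difference-antitone : ∀ {τ a a′ b b′} → a ≤ a′ → a ≤ b → b′ - b ≤ a′ - a →
                          τ ⊓ b′ - τ ⊓ b ≤ τ ⊓ a′ - τ ⊓ a
  ⊓-difference-antitone {τ} {a} {a′} {b} {b′} a≤a′ a≤b p =
    difference-exchange (lemma (≤-total τ b) (≤-total τ a′))
    where
    lemma : τ ≤ b ⊎ b ≤ τ → τ ≤ a′ ⊎ a′ ≤ τ → τ ⊓ b′ + τ ⊓ a ≤ τ ⊓ a′ + τ ⊓ b
    lemma (inj₁ τ≤b) _ = begin
      τ ⊓ b′ + τ ⊓ a  ≤⟨ +-mono-≤ (x⊓y≤x τ b′) (⊓-monoʳ-≤ τ a≤a′) ⟩
      τ + τ ⊓ a′      ≈⟨ +-comm τ (τ ⊓ a′) ⟩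
      τ ⊓ a′ + τ      ≈⟨ +-congˡ (x≤y⇒x⊓y≈x τ≤b) ⟨
      τ ⊓ a′ + τ ⊓ b  ∎
    lemma (inj₂ b≤τ) (inj₁ τ≤a′) = +-mono-≤
      (≤-trans (x⊓y≤x τ b′) (≤-reflexive (sym (x≤y⇒x⊓y≈x τ≤a′))))
      (⊓-monoʳ-≤ τ a≤b)
    lemma (inj₂ b≤τ) (inj₂ a′≤τ) = begin
      τ ⊓ b′ + τ ⊓ a  ≤⟨ +-mono-≤ (x⊓y≤y τ b′) (x⊓y≤y τ a) ⟩
      b′ + a          ≤⟨ difference-exchange⁻¹ p ⟩
      a′ + b          ≈⟨ +-cong (x≤y⇒y⊓x≈x a′≤τ) (x≤y⇒y⊓x≈x b≤τ) ⟨
      τ ⊓ a′ + τ ⊓ b  ∎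

-- Lower sums of the reciprocal and the logarithm.

module LogarithmLemmas {ℓ} (R : RealField ℓ) where
  open RealField R
  open OrderedFieldProperties R
  open OrderedFieldLemmas R
  open Logarithm R
  open PartialOrderReasoning (DecTotalOrder.poset decTotalOrder)

  empty-interval : ∀ {M a b} → a ≈ b → M * (b - a) ≈ 0#
  empty-interval {M} {a} {b} a≈b = begin-equality
    M * (b - a)  ≈⟨ *-congˡ (+-congˡ (-‿cong a≈b)) ⟩
    M * (b - b)  ≈⟨ *-congˡ (-‿inverseʳ b) ⟩
    M * 0#       ≈⟨ zeroʳ M ⟩
    0#           ∎

  LowerSum-≤-ln : ∀ {x s} → 1# ≤ x → LowerSum _⁻¹ 1# x s → s ≤ ln x
  LowerSum-≤-ln {x} {s} 1≤x S with x ≤? 0# | ≤-total 1# x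
  ... | yes x≤0 | _        = ⊥-elim (≰0 (<-≤-trans 0<1 1≤x) x≤0)
  ... | no _    | inj₁ 1≤x = proj₁ (proj₂ (∫⁻¹-supremum 1# x 0<1 1≤x)) s S
  -- Here `x ≈ 1#`, but `ln` has taken its branch for arguments at most one. Both the lower sum and
  -- the integral that is negated run over a degenerate interval, so each is at most zero.
  ... | no x≰0  | inj₂ x≤1 = begin
    s                         ≤⟨ LowerSum-bounded (λ _ → ⁻¹-antitone 0<1) S ⟩
    1# ⁻¹ * (x - 1#)          ≈⟨ empty-interval 1≈x ⟩
    0#                        ≈⟨ -‿inverseʳ _ ⟨
    ∫⁻¹ x 1# 0<x x≤1 - ∫⁻¹ x 1# 0<x x≤1
                              ≤⟨ +-monoˡ-≤ _ ∫≤0 ⟩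
    0# - ∫⁻¹ x 1# 0<x x≤1     ≈⟨ +-identityˡ _ ⟩
    - ∫⁻¹ x 1# 0<x x≤1        ∎
    where
    0<x : 0# < x
    0<x = ≰⇒> x≰0
    1≈x : 1# ≈ x
    1≈x = ≤-antisym 1≤x x≤1
    ∫≤0 : ∫⁻¹ x 1# 0<x x≤1 ≤ 0#
    ∫≤0 = proj₂ (proj₂ (∫⁻¹-supremum x 1# 0<x x≤1)) 0# (λ t T → ≤-trans
      (LowerSum-bounded (λ _ → ⁻¹-antitone 0<x) T) (≤-reflexive (empty-interval (sym 1≈x))))

  -- The reciprocal decreases, so on `[a , t]` its least value is `t ⁻¹`, taken at the right end.
  LowerSum-extendˡ : ∀ {a t b s} → 0# < a → a ≤ t →
                     LowerSum _⁻¹ t b s → LowerSum _⁻¹ a b (t ⁻¹ * (t - a) + s)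
  LowerSum-extendˡ 0<a a≤t =
    step a≤t (λ u a≤u → ⁻¹-antitone (<-≤-trans 0<a a≤u))

  -- One rectangle over `[1# , a]`, of nonnegative area, completes the lower sum to one starting at
  -- `1#`.
  tail-≤-ln : ∀ {a b s} → 1# ≤ a → a ≤ b → LowerSum _⁻¹ a b s → s ≤ ln b
  tail-≤-ln {a} {b} {s} 1≤a a≤b S = begin
    s                        ≈⟨ +-identityˡ s ⟨
    0# + s                   ≤⟨ +-monoˡ-≤ s (*-nonNeg (⁻¹-nonNeg (<-≤-trans 0<1 1≤a)) (sub-nonNeg 1≤a)) ⟩
    a ⁻¹ * (a - 1#) + s      ≤⟨ LowerSum-≤-ln (≤-trans 1≤a a≤b) (LowerSum-extendˡ 0<1 1≤a S) ⟩
    ln b                     ∎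

  ln-nonNeg : ∀ {x} → 1# ≤ x → 0# ≤ ln x
  ln-nonNeg {x} 1≤x = tail-≤-ln 1≤x ≤-refl (empty refl)

-- Finite sums over subsets.

module SumLemmas {ℓ} (R : RealField ℓ) where
  open RealField R
  open OrderedFieldLemmas R
  open Sum semiring using (sum-cong-≋; ∑-distrib-+; *-distribˡ-sum; sum-replicate-zero)

  sum-mono-≤ : ∀ {n} {v w : Fin n → ℝ} → (∀ i → v i ≤ w i) → sum v ≤ sum w
  sum-mono-≤ {zero}  v≤w = ≤-refl
  sum-mono-≤ {suc n} v≤w = +-mono-≤ (v≤w zero) (sum-mono-≤ (v≤w ∘ suc))

  module _ {n : ℕ} where
    open Cover R {n}

    restrict : (Fin n → ℝ) → Subset n → Fin n → ℝ
    restrict w X x = if does (x ∈? X) then w x else 0#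

    sumOver-mono-≤ : ∀ {v w} X → (∀ x → v x ≤ w x) → sumOver v X ≤ sumOver w X
    sumOver-mono-≤ X v≤w = sum-mono-≤ (λ x → if-mono-≤ (does (x ∈? X)) (v≤w x))
      where
      if-mono-≤ : ∀ b {y z} → y ≤ z → (if b then y else 0#) ≤ (if b then z else 0#)
      if-mono-≤ true  y≤z = y≤z
      if-mono-≤ false y≤z = ≤-refl

    sumOver-+ : ∀ v w X → sumOver (λ x → v x + w x) X ≈ sumOver v X + sumOver w X
    sumOver-+ v w X = trans
      (sum-cong-≋ {n} (λ x → if-+ (does (x ∈? X))))
      (∑-distrib-+ {n} (restrict v X) (restrict w X))
      where
      if-+ : ∀ b {y z} → (if b then y + z else 0#) ≈ (if b then y else 0#) + (if b then z else 0#)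
      if-+ true  = refl
      if-+ false = sym (+-identityˡ 0#)

    sumOver-* : ∀ a w X → sumOver (λ x → a * w x) X ≈ a * sumOver w X
    sumOver-* a w X = trans
      (sum-cong-≋ {n} (λ x → if-* (does (x ∈? X))))
      (sym (*-distribˡ-sum {n} a (restrict w X)))
      where
      if-* : ∀ b {y} → (if b then a * y else 0#) ≈ a * (if b then y else 0#)
      if-* true  = refl
      if-* false = sym (zeroʳ a)

    sumOver-∅ : ∀ w → sumOver w ⊥ ≈ 0#
    sumOver-∅ w = trans (sum-cong-≋ {n} vanish) (sum-replicate-zero n)
      where
      vanish : ∀ x → restrict w ⊥ x ≈ 0#
      vanish x with x ∈? ⊥
      ... | yes x∈⊥ = ⊥-elim (∉⊥ x∈⊥)
      ... | no _    = refl

-- Monotone submodular set functions and their truncations.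

module SetFunctionLemmas {ℓ} (R : RealField ℓ) {n : ℕ} where
  open RealField R
  open OrderedFieldProperties R
  open OrderedFieldLemmas R
  open SumLemmas R
  open Cover R {n}
  open IntegerCoefficients commutativeRing using (solve; _:=_; _:+_; _:-_)
  open PartialOrderReasoning (DecTotalOrder.poset decTotalOrder)
  open Min (DecTotalOrder.totalOrder decTotalOrder) using (⊓-monoʳ-≤)

  -- Unlike in `Submodular`, `x` may lie in `Y`; marginals at growing sets then compare without a
  -- membership test.
  DiminishingReturns : SetFunction → Set ℓ
  DiminishingReturns g = ∀ {X Y} x → X ⊆ Y → Δ g Y x ≤ Δ g X x

  ∪⁅⁆-⊆ : ∀ {X : Subset n} {x} → x ∈ X → X ∪ ⁅ x ⁆ ⊆ X
  ∪⁅⁆-⊆ {X} {x} x∈X z∈ with x∈p∪q⁻ X ⁅ x ⁆ z∈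
  ... | inj₁ z∈X = z∈X
  ... | inj₂ z∈x = ≡.subst (_∈ X) (≡.sym (x∈⁅y⁆⇒x≡y x z∈x)) x∈X

  Δ-nonNeg : ∀ {g} → Monotone g → ∀ X x → 0# ≤ Δ g X x
  Δ-nonNeg mono X x = sub-nonNeg (mono (p⊆p∪q ⁅ x ⁆))

  Δ-member : ∀ {g X x} → Monotone g → x ∈ X → Δ g X x ≤ 0#
  Δ-member {g} {X} {x} mono x∈X = begin
    g (X ∪ ⁅ x ⁆) - g X  ≤⟨ +-monoˡ-≤ (- g X) (mono (∪⁅⁆-⊆ x∈X)) ⟩
    g X - g X            ≈⟨ -‿inverseʳ (g X) ⟩
    0#                   ∎

  -- The added case `x ∈ Y` needs monotonicity: the marginal at `Y` is at most zero, the one at `X`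
  -- nonnegative.
  diminishingReturns : ∀ {g} → Monotone g → Submodular g → DiminishingReturns g
  diminishingReturns mono submod {X} {Y} x X⊆Y with x ∈? Y
  ... | yes x∈Y = ≤-trans (Δ-member mono x∈Y) (Δ-nonNeg mono X x)
  ... | no  x∉Y = submod X⊆Y x∉Y

  Δ-≤-singleton : ∀ {g} → DiminishingReturns g → 0# ≤ g ⊥ → ∀ X x → Δ g X x ≤ g ⁅ x ⁆
  Δ-≤-singleton {g} dim 0≤g⊥ X x = begin
    Δ g X x                ≤⟨ dim x ⊥⊆ ⟩
    g (⊥ ∪ ⁅ x ⁆) - g ⊥    ≡⟨ ≡.cong (λ Y → g Y - g ⊥) (∪-identityˡ ⁅ x ⁆) ⟩
    g ⁅ x ⁆ - g ⊥          ≤⟨ ≤-from-difference 0≤g⊥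
                                (solve 2 (λ a b → a :- (a :- b) := b) refl (g ⁅ x ⁆) (g ⊥)) ⟩
    g ⁅ x ⁆                ∎

  truncate-monotone : ∀ {τ g} → Monotone g → Monotone (truncate τ g)
  truncate-monotone {τ} mono X⊆Y = ⊓-monoʳ-≤ τ (mono X⊆Y)

  truncate-diminishingReturns : ∀ {τ g} → Monotone g → DiminishingReturns g →
                                DiminishingReturns (truncate τ g)
  truncate-diminishingReturns mono dim x X⊆Y =
    ⊓-difference-antitone (mono (p⊆p∪q ⁅ x ⁆)) (mono X⊆Y) (dim x X⊆Y)

  -- The sets ⁅ e i ⁆ with p i are added to B one at a time, each for at most
  -- its marginal at B.

  grow : ∀ {g} → Monotone g → DiminishingReturns g →
         ∀ B {m} (e : Fin m → Fin n) (p : Fin m → Bool) →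
         ∃ λ Y → B ⊆ Y × (∀ i → p i ≡ true → e i ∈ Y) ×
                 g Y - g B ≤ sum (λ i → if p i then Δ g B (e i) else 0#)
  grow {g} mono dim B {zero} e p = B , id , (λ ()) , ≤-reflexive (-‿inverseʳ (g B))
  grow {g} mono dim B {suc m} e p
    with grow mono dim B (e ∘ suc) (p ∘ suc) | p zero in p₀
  ... | Y , B⊆Y , e∈Y , bound | false =
    Y , B⊆Y
    , (λ { zero eq → ⊥-elim (false≢true (≡.trans (≡.sym p₀) eq)) ; (suc i) → e∈Y i })
    , ≤-trans bound (≤-reflexive (sym (+-identityˡ _)))
    where
    false≢true : ¬ (false ≡ true)
    false≢true ()
  ... | Y , B⊆Y , e∈Y , bound | true =
    Y ∪ ⁅ x ⁆ , p⊆p∪q ⁅ x ⁆ ∘ B⊆Y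
    , (λ { zero _ → q⊆p∪q Y ⁅ x ⁆ (x∈⁅x⁆ x) ; (suc i) eq → p⊆p∪q ⁅ x ⁆ (e∈Y i eq) })
    , (begin
      g (Y ∪ ⁅ x ⁆) - g B        ≈⟨ solve 3 (λ a b c → a :- b := a :- c :+ (c :- b))
                                      refl (g (Y ∪ ⁅ x ⁆)) (g B) (g Y) ⟩
      Δ g Y x + (g Y - g B)      ≤⟨ +-mono-≤ (dim x B⊆Y) bound ⟩
      Δ g B x + _                ∎)
    where
    x : Fin n
    x = e zero

  -- This is `grow` with all elements listed and membership in `X` as selector. The set obtained
  -- contains `X`, and monotonicity passes from it to `X`.
  difference-≤-marginals : ∀ {g} → Monotone g → DiminishingReturns g →
                           ∀ B X → g X - g B ≤ sumOver (Δ g B) X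
  difference-≤-marginals {g} mono dim B X with grow mono dim B id (λ x → does (x ∈? X))
  ... | Y , _ , X⊆Y , bound = ≤-trans (+-monoˡ-≤ (- g B) (mono X⊆Y′)) bound
    where
    X⊆Y′ : X ⊆ Y
    X⊆Y′ {x} x∈X = X⊆Y x (dec-true (x ∈? X) x∈X)

-- Charging the cost to the elements of a cover.

module Charging {ℓ} (R : RealField ℓ) where
  open RealField R
  open OrderedFieldProperties R
  open OrderedFieldLemmas R
  open LogarithmLemmas R
  open Logarithm R
  open SumLemmas R
  open IntegerCoefficients commutativeRing using (solve; _:=_; _:+_; _:*_; _:-_; con)
  open PartialOrderReasoning (DecTotalOrder.poset decTotalOrder)

  module Charges {α β : ℝ} (0<β : 0# < β) (β≤α : β ≤ α) where

    L : ℝ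
    L = ln (α / β)

    L+1-nonNeg : 0# ≤ L + 1#
    L+1-nonNeg = +-nonNeg (ln-nonNeg (1≤/ 0<β β≤α)) 0≤1

    -- W = Σ (Qᵢ₊₁ - Qᵢ) hᵢ is the charge of an element with marginals hᵢ at
    -- prices Qᵢ; summation by parts bounds it by C times an upper-endpoint
    -- Riemann sum of 1/t between h / β and α / β, plus the boundary term Q h.

    data Charge (C Q h W : ℝ) : Set ℓ where
      active : ∀ {s} → β ≤ h → h ≤ α → LowerSum _⁻¹ (h / β) (α / β) s →
               W ≤ C * s + Q * h → Charge C Q h W
      spent  : h ≤ 0# → W ≤ C * (L + 1#) → Charge C Q h W

    tail-≤-L : ∀ {h s} → β ≤ h → h ≤ α → LowerSum _⁻¹ (h / β) (α / β) s → s ≤ L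
    tail-≤-L β≤h h≤α = tail-≤-ln (1≤/ 0<β β≤h) (/-monoˡ-≤ 0<β h≤α)

    -- The `1#` added to `L` pays for a boundary term `y`, which is `Q * h` or `Q′ * h` in the
    -- applications.
    active-bound : ∀ {C y s W} → 0# ≤ C → y ≤ C → s ≤ L → W ≤ C * s + y → W ≤ C * (L + 1#)
    active-bound {C} {y} {s} {W} 0≤C y≤C s≤L W≤ = begin
      W               ≤⟨ W≤ ⟩
      C * s + y       ≤⟨ +-mono-≤ (*-monoˡ-≤ 0≤C s≤L) y≤C ⟩
      C * L + C       ≈⟨ solve 2 (λ C L → C :* L :+ C := C :* (L :+ con (+ 1))) refl C L ⟩
      C * (L + 1#)    ∎

    Charge-≤ : ∀ {C Q h W} → 0# ≤ C → Q * h ≤ C → Charge C Q h W → W ≤ C * (L + 1#)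
    Charge-≤ 0≤C Qh≤C (active β≤h h≤α S W≤) = active-bound 0≤C Qh≤C (tail-≤-L β≤h h≤α S) W≤
    Charge-≤ 0≤C Qh≤C (spent _ W≤)          = W≤

    Charge-start : ∀ {C h} → 0# ≤ C → h ≤ α → (0# < h → β ≤ h) → Charge C 0# h 0#
    Charge-start {C} {h} 0≤C h≤α pos⇒β≤ with h ≤? 0#
    ... | yes h≤0 = spent h≤0 (*-nonNeg 0≤C L+1-nonNeg)
    -- A single rectangle covers `[h / β , α / β]`. Its area is nonnegative, and the price zero
    -- kills the boundary term.
    ... | no  h≰0 = active β≤h h≤α (LowerSum-extendˡ 0<h/β h/β≤α/β (empty refl)) (begin
      0#                                    ≤⟨ *-nonNeg 0≤C (+-nonNeg
                                                 (*-nonNeg (⁻¹-nonNeg (<-≤-trans 0<h/β h/β≤α/β))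
                                                   (sub-nonNeg h/β≤α/β)) ≤-refl) ⟩
      C * _                                 ≈⟨ +-identityʳ _ ⟨
      C * _ + 0#                            ≈⟨ +-congˡ (zeroˡ h) ⟨
      C * _ + 0# * h                        ∎)
      where
      β≤h : β ≤ h
      β≤h = pos⇒β≤ (≰⇒> h≰0)
      0<h/β : 0# < h / β
      0<h/β = <-≤-trans 0<1 (1≤/ 0<β β≤h)
      h/β≤α/β : h / β ≤ α / β
      h/β≤α/β = /-monoˡ-≤ 0<β h≤α

    -- Adding `(Q′ - Q) * h` turns the boundary term `Q * h` into `Q′ * h`, which splits into the
    -- new boundary term `Q′ * h′` and `Q′ * (h - h′)`. As `Q′ * h ≤ C`, the latter is at most
    -- `C * (h - h′) / h` while `h` and `h′` are positive, that is, `C` times the rectangle over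
    -- `[h′ / β , h / β]` of height `(h / β) ⁻¹`.
    Charge-step : ∀ {C Q Q′ h h′ W} → 0# ≤ C → Q ≤ Q′ → Q′ * h ≤ C → h′ ≤ h → (0# < h′ → β ≤ h′) →
                  Charge C Q h W → Charge C Q′ h′ (W + (Q′ - Q) * h)
    -- With `h ≤ 0#` a rise of the price cannot increase the charge, so the stored bound persists.
    Charge-step {C} {Q} {Q′} {h} {h′} {W} 0≤C Q≤Q′ Q′h≤C h′≤h pos⇒β≤ (spent h≤0 W≤) =
      spent (≤-trans h′≤h h≤0) (begin
        W + (Q′ - Q) * h    ≤⟨ +-monoʳ-≤ W (*-monoˡ-≤ (sub-nonNeg Q≤Q′) h≤0) ⟩
        W + (Q′ - Q) * 0#   ≈⟨ +-congˡ (zeroʳ _) ⟩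
        W + 0#              ≈⟨ +-identityʳ W ⟩
        W                   ≤⟨ W≤ ⟩
        C * (L + 1#)        ∎)
    Charge-step {C} {Q} {Q′} {h} {h′} {W} 0≤C Q≤Q′ Q′h≤C h′≤h pos⇒β≤ (active {s} β≤h h≤α S W≤)
      with h′ ≤? 0#
    -- The marginal drops from at least `β` to at most zero, so no rectangle is added: the whole of
    -- `Q′ * h` is absorbed by `C`, once and for all.
    ... | yes h′≤0 = spent h′≤0 (active-bound 0≤C Q′h≤C (tail-≤-L β≤h h≤α S)
      (≤-from-difference (sub-nonNeg W≤)
        (solve 6 (λ C Q Q′ h s W → C :* s :+ Q′ :* h :- (W :+ (Q′ :- Q) :* h)
                                := C :* s :+ Q :* h :- W)
          refl C Q Q′ h s W)))
    ... | no h′≰0 = active β≤h′ (≤-trans h′≤h h≤α)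
      (LowerSum-extendˡ 0<h′/β h′/β≤h/β S)
      (≤-from-difference
        (+-nonNeg (sub-nonNeg W≤)
          (*-nonNeg (sub-nonNeg Q′h≤C) (*-nonNeg (⁻¹-nonNeg 0<h/β) (sub-nonNeg h′/β≤h/β))))
        (begin-equality
          C * (m * (h / β - h′ / β) + s) + Q′ * h′ - (W + (Q′ - Q) * h)
            -- The solver treats `m` and `β ⁻¹` as free variables. That `m` inverts `h / β` enters
            -- through the last summand, which is a multiple of `h / β * m - 1#`.
            ≈⟨ solve 9 (λ C Q Q′ h h′ s W m b →
                 C :* (m :* (h :* b :- h′ :* b) :+ s) :+ Q′ :* h′ :- (W :+ (Q′ :- Q) :* h)
                 := C :* s :+ Q :* h :- W :+ (C :- Q′ :* h) :* (m :* (h :* b :- h′ :* b))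
                    :+ Q′ :* (h :- h′) :* (h :* b :* m :- con (+ 1)))
               refl C Q Q′ h h′ s W m (β ⁻¹) ⟩
          C * s + Q * h - W + (C - Q′ * h) * (m * (h / β - h′ / β))
            + Q′ * (h - h′) * (h / β * m - 1#)
            ≈⟨ +-congˡ (trans (*-congˡ hm-1≈0) (zeroʳ _)) ⟩
          C * s + Q * h - W + (C - Q′ * h) * (m * (h / β - h′ / β)) + 0#
            ≈⟨ +-identityʳ _ ⟩
          C * s + Q * h - W + (C - Q′ * h) * (m * (h / β - h′ / β)) ∎))
      where
      β≤h′ : β ≤ h′
      β≤h′ = pos⇒β≤ (≰⇒> h′≰0)
      0<h′/β : 0# < h′ / β
      0<h′/β = <-≤-trans 0<1 (1≤/ 0<β β≤h′)
      h′/β≤h/β : h′ / β ≤ h / β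
      h′/β≤h/β = /-monoˡ-≤ 0<β h′≤h
      0<h/β : 0# < h / β
      0<h/β = <-≤-trans 0<h′/β h′/β≤h/β
      m : ℝ
      m = (h / β) ⁻¹
      hm-1≈0 : h / β * m - 1# ≈ 0#
      hm-1≈0 = trans (+-congʳ (inverse 0<h/β)) (-‿inverseʳ 1#)

    -- The run is reduced to inequalities between costs, residuals `r` and marginals `h`. The prices
    -- supplied by `price` may go up or down from one iteration to the next.
    module _ {n k : ℕ} (X : Subset n) (C : Fin n → ℝ)
             (cost r : Fin (suc k) → ℝ) (h : Fin (suc k) → Fin n → ℝ)
             (0≤C : ∀ x → 0# ≤ C x)
             (cost₀≤0 : cost zero ≤ 0#)
             (r≤Σh : ∀ i → r i ≤ Cover.sumOver R (h i) X)
             (r-antitone : ∀ i → r (suc i) ≤ r (inject₁ i))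
             (h-antitone : ∀ i x → h (suc i) x ≤ h (inject₁ i) x)
             (h≤α : ∀ x → h zero x ≤ α)
             (β≤h : ∀ i x → 0# < h i x → β ≤ h i x)
             (price : ∀ i → ∃ λ q → cost (suc i) ≤ cost (inject₁ i) + q * (r (inject₁ i) - r (suc i)) ×
                                    (∀ x → q * h (inject₁ i) x ≤ C x))
             where

      open Cover R {n}

      -- Q is the running maximum of the prices.

      record State (i : Fin (suc k)) : Set ℓ where
        field
          Q        : ℝ
          W        : Fin n → ℝ
          Q-nonNeg : 0# ≤ Q
          cost-≤   : cost i + Q * r i ≤ sumOver W X
          Qh≤C     : ∀ x → Q * h i x ≤ C x
          charge   : ∀ x → Charge (C x) Q (h i x) (W x)

      initial : State zero
      initial = record
        { Q        = 0#
        ; W        = λ _ → 0#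
        ; Q-nonNeg = ≤-refl
        ; cost-≤   = begin
            cost zero + 0# * r zero    ≤⟨ +-mono-≤ cost₀≤0 (≤-reflexive (zeroˡ _)) ⟩
            0# + 0#                    ≈⟨ +-identityˡ 0# ⟩
            0#                         ≈⟨ zeroˡ _ ⟨
            0# * sumOver (λ _ → 0#) X  ≈⟨ sumOver-* 0# (λ _ → 0#) X ⟨
            sumOver (λ _ → 0# * 0#) X  ≤⟨ sumOver-mono-≤ X (λ _ → ≤-reflexive (zeroˡ 0#)) ⟩
            sumOver (λ _ → 0#) X       ∎
        ; Qh≤C     = λ x → ≤-trans (≤-reflexive (zeroˡ _)) (0≤C x)
        ; charge   = λ x → Charge-start (0≤C x) (h≤α x) (β≤h zero x)
        }

      -- The invariant `cost-≤` carries the boundary term `Q * r` of a summation by parts. Raising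
      -- `Q` to `Q′` adds `(Q′ - Q) * r`, covered by the new charges since `r` is at most the sum of
      -- the marginals. The fall of `r`, valued at `Q′ ≥ q`, then pays for the cost of the
      -- iteration.
      next : ∀ i → State (inject₁ i) → State (suc i)
      next i state with price i
      ... | q , cost-step , qh≤C with max-≤ (State.Q state) q
      ... | Q′ , Q≤Q′ , q≤Q′ , bound = record
        { Q        = Q′
        ; W        = λ x → W x + (Q′ - Q) * hᵢ x
        ; Q-nonNeg = 0≤Q′
        ; cost-≤   = begin
            cost (suc i) + Q′ * r′                           ≤⟨ ≤-from-difference
              (+-nonNeg (+-nonNeg (sub-nonNeg cost-≤) (sub-nonNeg cost-step))
                (+-nonNeg (*-nonNeg (sub-nonNeg Q≤Q′) (sub-nonNeg (r≤Σh (inject₁ i))))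
                  (*-nonNeg (sub-nonNeg q≤Q′) (sub-nonNeg (r-antitone i)))))
              (solve 9 (λ a b Q Q′ q r r′ V H →
                V :+ (Q′ :- Q) :* H :- (b :+ Q′ :* r′)
                := V :- (a :+ Q :* r) :+ (a :+ q :* (r :- r′) :- b)
                   :+ ((Q′ :- Q) :* (H :- r) :+ (Q′ :- q) :* (r :- r′)))
                refl (cost (inject₁ i)) (cost (suc i)) Q Q′ q (r (inject₁ i)) r′
                  (sumOver W X) (sumOver hᵢ X)) ⟩
            sumOver W X + (Q′ - Q) * sumOver hᵢ X            ≈⟨ +-congˡ (sumOver-* (Q′ - Q) hᵢ X) ⟨
            sumOver W X + sumOver (λ x → (Q′ - Q) * hᵢ x) X  ≈⟨ sumOver-+ W (λ x → (Q′ - Q) * hᵢ x) X ⟨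
            sumOver (λ x → W x + (Q′ - Q) * hᵢ x) X          ∎
        ; Qh≤C     = λ x → ≤-trans (*-monoˡ-≤ 0≤Q′ (h-antitone i x)) (Q′h≤C x)
        ; charge   = λ x → Charge-step (0≤C x) Q≤Q′ (Q′h≤C x) (h-antitone i x) (β≤h (suc i) x) (charge x)
        }
        where
        open State state
        hᵢ : Fin n → ℝ
        hᵢ = h (inject₁ i)
        r′ : ℝ
        r′ = r (suc i)
        0≤Q′ : 0# ≤ Q′
        0≤Q′ = ≤-trans Q-nonNeg Q≤Q′
        Q′h≤C : ∀ x → Q′ * hᵢ x ≤ C x
        -- Old maximum and new price are both tested against the marginals before the iteration.
        Q′h≤C x = bound (Qh≤C x) (qh≤C x)

      cost-≤-charges : ∀ i → 0# ≤ r i → cost i ≤ (L + 1#) * sumOver C X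
      cost-≤-charges i 0≤r = begin
        cost i                             ≈⟨ +-identityʳ (cost i) ⟨
        -- The boundary term is nonnegative and is discarded only here, at the end.
        cost i + 0#                        ≤⟨ +-monoʳ-≤ (cost i) (*-nonNeg Q-nonNeg 0≤r) ⟩
        cost i + Q * r i                   ≤⟨ cost-≤ ⟩
        sumOver W X                        ≤⟨ sumOver-mono-≤ X (λ x →
                                                ≤-trans (Charge-≤ (0≤C x) (Qh≤C x) (charge x))
                                                  (≤-reflexive (*-comm _ _))) ⟩
        sumOver (λ x → (L + 1#) * C x) X   ≈⟨ sumOver-* (L + 1#) C X ⟩
        (L + 1#) * sumOver C X             ∎
        where open State (<-weakInduction State initial next i)

-- Greedy runs with an approximate oracle.

module Greedy {ℓ} (R : RealField ℓ) {n : ℕ} where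
  open RealField R
  open Cover R {n}
  open OrderedFieldProperties R
  open OrderedFieldLemmas R
  open SetFunctionLemmas R
  open SumLemmas R
  open Logarithm R
  open RingProperties ring using (-0#≈0#)
  open IntegerCoefficients commutativeRing using (solve; _:=_; _:+_; _:*_; :-_; _:-_; con)
  open PartialOrderReasoning (DecTotalOrder.poset decTotalOrder) hiding (start)
  open Min (DecTotalOrder.totalOrder decTotalOrder) using (x⊓y≤x; x≤y⇒x⊓y≈x)

  module Analysis
    {f c : SetFunction} {τ : ℝ} (scsc : IsSCSC f c τ)
    {ε : ℝ} (0≤ε : 0# ≤ ε) {F : SetFunction} (approx : IsApproximate ε f F)
    {k : ℕ} (run : GreedyRun F c τ k)
    where
    open IsSCSC scsc
    open GreedyRun run

    output-feasible : f output ≥ τ - ε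
    output-feasible = ≤-+⇒-≤ (≤-trans finish (∣-∣≤⇒≥+ (approx output)))

    fτ Fτ : SetFunction
    fτ = truncate τ f
    Fτ = truncate τ F

    f-dim : DiminishingReturns f
    f-dim = diminishingReturns f-monotone f-submodular

    fτ-monotone : Monotone fτ
    fτ-monotone = truncate-monotone f-monotone

    fτ-dim : DiminishingReturns fτ
    fτ-dim = truncate-diminishingReturns f-monotone f-dim

    c-dim : DiminishingReturns c
    c-dim = diminishingReturns c-monotone c-submodular

    c-⊥ : c ⊥ ≈ 0#
    c-⊥ = Equivalence.from (c-zero ⊥) ≡.refl

    c-pos : ∀ {X} → Nonempty X → 0# < c X
    c-pos {X} (x , x∈X) = c-nonNegative X , λ 0≈cX →
      ∉⊥ (≡.subst (x ∈_) (Equivalence.to (c-zero X) (sym 0≈cX)) x∈X)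

    c⁅_⁆-pos : ∀ x → 0# < c ⁅ x ⁆
    c⁅ x ⁆-pos = c-pos (x , x∈⁅x⁆ x)

    A-grows : ∀ i → A (inject₁ i) ⊆ A (suc i)
    A-grows i = ≡.subst (A (inject₁ i) ⊆_) (≡.sym (update i)) (p⊆p∪q ⁅ u i ⁆)

    ΔFτ-≤ : ∀ X x → Δ Fτ X x ≤ Δ fτ X x + 2# * ε
    ΔFτ-≤ X x = difference-shift (τ⊓-shift 0≤ε (∣-∣≤⇒≥+ (approx _))) (τ⊓-shift 0≤ε (∣-∣≤⇒≤+ (approx X)))

    Δfτ-≤ : ∀ X x → Δ fτ X x ≤ Δ Fτ X x + 2# * ε
    Δfτ-≤ X x = difference-shift (τ⊓-shift 0≤ε (∣-∣≤⇒≤+ (approx _))) (τ⊓-shift 0≤ε (∣-∣≤⇒≥+ (approx X)))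

    -- Subadditivity, read off from the marginals at the empty set. Applied to a singleton it gives
    -- `1≤ρ` without evaluating a sum.
    c-≤-sum : ∀ X → c X ≤ sumOver (λ x → c ⁅ x ⁆) X
    c-≤-sum X = begin
      c X                        ≈⟨ trans (+-congˡ (trans (-‿cong c-⊥) -0#≈0#)) (+-identityʳ _) ⟨
      c X - c ⊥                  ≤⟨ difference-≤-marginals c-monotone c-dim ⊥ X ⟩
      sumOver (Δ c ⊥) X          ≤⟨ sumOver-mono-≤ X (Δ-≤-singleton c-dim (c-nonNegative ⊥) ⊥) ⟩
      sumOver (λ x → c ⁅ x ⁆) X  ∎

    -- Cost of the output.

    module _ {A* : Subset n} (f[A*]≥τ : f A* ≥ τ) {α β μ ρ cmin cmax : ℝ}
             (isα : IsMaxSingleton f α) (isβ : IsMinPositiveMarginal run f β)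
             (isμ : IsMinGain run f μ) (isρ : IsCurvature c ρ)
             (isCmin : IsMinSingleton c cmin) (isCmax : IsMaxSingleton c cmax)
             (μ> : μ > 4# * ε * cmax * ρ / cmin) where

      -- `E` is the correction in the stated bound and equals `ρ * η`. `K` is the factor lost by
      -- choosing greedily with respect to `F` instead of `f`.
      E η K : ℝ
      E = 4# * ε * cmax * ρ / (cmin * μ)
      η = 4# * ε * cmax / (cmin * μ)
      K = 1# + η

      gain : Fin k → ℝ
      gain i = fτ (A (suc i)) - fτ (A (inject₁ i))

      h : Fin (suc k) → Fin n → ℝ
      h i = Δ fτ (A i)

      0≤4ε : 0# ≤ 4# * ε
      0≤4ε = *-nonNeg (+-nonNeg (+-nonNeg 0≤1 0≤1) (+-nonNeg 0≤1 0≤1)) 0≤ε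

      0<cmin : 0# < cmin
      0<cmin = let (x , _ , c≈cmin) , _ = isCmin in
        <-≤-trans c⁅ x ⁆-pos (≤-reflexive c≈cmin)

      cmin≤ : ∀ x → cmin ≤ c ⁅ x ⁆
      cmin≤ x = proj₂ isCmin x _

      ≤cmax : ∀ x → c ⁅ x ⁆ ≤ cmax
      ≤cmax x = proj₂ isCmax x _

      0≤cmax : 0# ≤ cmax
      0≤cmax = let (x , _ , c≈cmax) , _ = isCmax in
        ≤-trans (c-nonNegative ⁅ x ⁆) (≤-reflexive c≈cmax)

      1≤ρ : 1# ≤ ρ
      1≤ρ = let (x , _) , _ = isCmax in
        ≤-trans (1≤/ c⁅ x ⁆-pos (c-≤-sum ⁅ x ⁆)) (proj₂ isρ ⁅ x ⁆ (x , x∈⁅x⁆ x))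

      0≤ρ : 0# ≤ ρ
      0≤ρ = ≤-trans 0≤1 1≤ρ

      0≤4εcmax : 0# ≤ 4# * ε * cmax
      0≤4εcmax = *-nonNeg 0≤4ε 0≤cmax

      0<μ : 0# < μ
      0<μ = ≤-<-trans (*-nonNeg (*-nonNeg 0≤4εcmax 0≤ρ) (⁻¹-nonNeg 0<cmin)) μ>

      0<cmin*μ : 0# < cmin * μ
      0<cmin*μ = *-pos 0<cmin 0<μ

      0≤η : 0# ≤ η
      0≤η = *-nonNeg 0≤4εcmax (⁻¹-nonNeg 0<cmin*μ)

      0≤K : 0# ≤ K
      0≤K = +-nonNeg 0≤1 0≤η

      μ≤gain : ∀ i → μ ≤ gain i
      μ≤gain i = proj₂ isμ i _

      0<gain : ∀ i → 0# < gain i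
      0<gain i = <-≤-trans 0<μ (μ≤gain i)

      -- The hypothesis on `μ`, multiplied by `cmin` and divided by `cmin * μ`, says `E < 1#`.
      -- Strictness is a separate half: `E ≈ 1#` would make the two sides of that hypothesis equal.
      0<1-E : 0# < 1# - E
      0<1-E = sub-nonNeg E≤1 , λ 0≈1-E → proj₂ μ> (≤-antisym (proj₁ μ>) (*≤⇒≤/ 0<cmin (begin
        μ * cmin                   ≈⟨ *-comm μ cmin ⟩
        cmin * μ                   ≈⟨ *-identityˡ _ ⟨
        1# * (cmin * μ)            ≤⟨ *-monoʳ-≤ (proj₁ 0<cmin*μ)
                                        (sub-nonNeg⁻¹ (≤-reflexive (0≈E-1 0≈1-E))) ⟩
        E * (cmin * μ)             ≈⟨ /-cancelʳ _ 0<cmin*μ ⟩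
        4# * ε * cmax * ρ          ∎)))
        where
        E≤1 : E ≤ 1#
        E≤1 = ≤*⇒/≤ 0<cmin*μ (begin
          4# * ε * cmax * ρ        ≤⟨ /≤⇒≤* 0<cmin (proj₁ μ>) ⟩
          μ * cmin                 ≈⟨ *-comm μ cmin ⟩
          cmin * μ                 ≈⟨ *-identityˡ _ ⟨
          1# * (cmin * μ)          ∎)
        0≈E-1 : 0# ≈ 1# - E → 0# ≈ E - 1#
        0≈E-1 p = begin-equality
          0#                       ≈⟨ -0#≈0# ⟨
          - 0#                     ≈⟨ -‿cong p ⟩
          - (1# - E)               ≈⟨ solve 1 (λ E → :- (con (+ 1) :- E) := E :- con (+ 1)) refl E ⟩
          E - 1#                   ∎

      -- With `E = ρη`, the difference `1 - (1 + η)(1 - ρη)` is `η(ρ - 1) + ρη²`, nonnegative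
      -- because `1 ≤ ρ`.
      Kρ≤ρ/[1-E] : K * ρ ≤ ρ / (1# - E)
      Kρ≤ρ/[1-E] = *≤⇒≤/ 0<1-E (≤-from-difference
        (*-nonNeg 0≤ρ (+-nonNeg (*-nonNeg 0≤η (sub-nonNeg 1≤ρ)) (*-nonNeg 0≤ρ (*-nonNeg 0≤η 0≤η))))
        (solve 3 (λ ρ m i → let :η = m :* i in
          ρ :- (con (+ 1) :+ :η) :* ρ :* (con (+ 1) :- m :* ρ :* i)
          := ρ :* (:η :* (ρ :- con (+ 1)) :+ ρ :* (:η :* :η)))
          refl ρ (4# * ε * cmax) ((cmin * μ) ⁻¹)))

      gain≡Δ : ∀ i → gain i ≡ Δ fτ (A (inject₁ i)) (u i)
      gain≡Δ i = ≡.cong (λ Y → fτ Y - fτ (A (inject₁ i))) (update i)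

      -- The comparison of prices with denominators cleared. Passing from the marginals of `Fτ` to
      -- those of `fτ` in `argmax` costs `2ε (c(u) + c(x)) ≤ 4ε cmax`. By the choice of `η` this
      -- equals `η cmin μ`, hence is at most `η c(x)` times the gain.
      greedy-choice : ∀ i x → c ⁅ u i ⁆ * h (inject₁ i) x ≤ K * c ⁅ x ⁆ * gain i
      greedy-choice i x with x ∈? A (inject₁ i)
      -- `argmax` is silent about elements already chosen, but their marginals are at most zero.
      ... | yes x∈A = begin
        c ⁅ u i ⁆ * h (inject₁ i) x  ≤⟨ *-monoˡ-≤ (c-nonNegative _) (Δ-member fτ-monotone x∈A) ⟩
        c ⁅ u i ⁆ * 0#               ≈⟨ zeroʳ _ ⟩
        0#                           ≤⟨ *-nonNeg (*-nonNeg 0≤K (c-nonNegative _)) (proj₁ (0<gain i)) ⟩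
        K * c ⁅ x ⁆ * gain i         ∎
      ... | no x∉A = ≤-from-difference
        (+-nonNeg
          (+-nonNeg
            (*-nonNeg (c-nonNegative ⁅ u i ⁆) (sub-nonNeg (Δfτ-≤ X x)))
            (+-nonNeg
              (sub-nonNeg (cross-multiply c⁅ x ⁆-pos c⁅ u i ⁆-pos (argmax i x x∉A)))
              (*-nonNeg (c-nonNegative ⁅ x ⁆) (sub-nonNeg Δu≤))))
          (+-nonNeg
            (*-nonNeg 0≤η (+-nonNeg
              (*-nonNeg (c-nonNegative ⁅ x ⁆) (sub-nonNeg (μ≤gain i)))
              (*-nonNeg (proj₁ 0<μ) (sub-nonNeg (cmin≤ x)))))
            (*-nonNeg (*-nonNeg (+-nonNeg 0≤1 0≤1) 0≤ε)
              (+-nonNeg (sub-nonNeg (≤cmax x)) (sub-nonNeg (≤cmax (u i)))))))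
        (begin-equality
          K * cx * δ - cu * hx
            -- All summands but the last are slacks of the estimates above; the last one vanishes by
            -- the definition of `η`.
            ≈⟨ solve 11 (λ η cx cu δ hx Dx Du ε μ cmin cmax →
                 let :2 = con (+ 2); :4 = :2 :+ :2 in
                 (con (+ 1) :+ η) :* cx :* δ :- cu :* hx
                 := cu :* (Dx :+ :2 :* ε :- hx) :+ (Du :* cx :- Dx :* cu :+ cx :* (δ :+ :2 :* ε :- Du))
                    :+ (η :* (cx :* (δ :- μ) :+ μ :* (cx :- cmin))
                        :+ :2 :* ε :* (cmax :- cx :+ (cmax :- cu)))
                    :+ (η :* (cmin :* μ) :- :4 :* ε :* cmax))
               refl η cx cu δ hx (Δ Fτ X x) (Δ Fτ X (u i)) ε μ cmin cmax ⟩
          _ + (η * (cmin * μ) - 4# * ε * cmax)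
            ≈⟨ +-congˡ (trans (+-congʳ (/-cancelʳ _ 0<cmin*μ)) (-‿inverseʳ _)) ⟩
          _ + 0#
            ≈⟨ +-identityʳ _ ⟩
          _ ∎)
        where
        X : Subset n
        X = A (inject₁ i)
        cx cu δ hx : ℝ
        cx = c ⁅ x ⁆
        cu = c ⁅ u i ⁆
        δ  = gain i
        hx = h (inject₁ i) x
        Δu≤ : Δ Fτ X (u i) ≤ gain i + 2# * ε
        Δu≤ = ≡.subst (λ d → Δ Fτ X (u i) ≤ d + 2# * ε) (≡.sym (gain≡Δ i)) (ΔFτ-≤ X (u i))

      residual : Fin (suc k) → ℝ
      residual i = τ - fτ (A i)

      residual-drop : ∀ i → residual (inject₁ i) - residual (suc i) ≈ gain i
      residual-drop i = solve 3 (λ t a b → t :- a :- (t :- b) := b :- a) refl τ _ _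

      price : ∀ i → ∃ λ q →
              c (A (suc i)) ≤ c (A (inject₁ i)) + q * (residual (inject₁ i) - residual (suc i)) ×
              (∀ x → q * h (inject₁ i) x ≤ K * c ⁅ x ⁆)
      price i = c ⁅ u i ⁆ / gain i , cost-step , price-≤
        where
        X : Subset n
        X = A (inject₁ i)
        cost-step : c (A (suc i)) ≤ c X + c ⁅ u i ⁆ / gain i * (residual (inject₁ i) - residual (suc i))
        cost-step = begin
          c (A (suc i))                    ≡⟨ ≡.cong c (update i) ⟩
          c (X ∪ ⁅ u i ⁆)                  ≈⟨ solve 2 (λ a b → a := b :+ (a :- b)) refl _ (c X) ⟩
          -- By submodularity an element never costs more than it does alone.
          c X + Δ c X (u i)                ≤⟨ +-monoʳ-≤ (c X)
                                               (Δ-≤-singleton c-dim (c-nonNegative ⊥) X (u i)) ⟩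
          c X + c ⁅ u i ⁆                  ≈⟨ +-congˡ (/-cancelʳ _ (0<gain i)) ⟨
          c X + c ⁅ u i ⁆ / gain i * gain i
                                           ≈⟨ +-congˡ (*-congˡ (residual-drop i)) ⟨
          c X + c ⁅ u i ⁆ / gain i * (residual (inject₁ i) - residual (suc i)) ∎
        price-≤ : ∀ x → c ⁅ u i ⁆ / gain i * h (inject₁ i) x ≤ K * c ⁅ x ⁆
        price-≤ x = begin
          c ⁅ u i ⁆ / gain i * h (inject₁ i) x
            ≈⟨ solve 3 (λ a b d → a :* b :* d := a :* d :* b) refl _ _ _ ⟩
          c ⁅ u i ⁆ * h (inject₁ i) x / gain i
            ≤⟨ ≤*⇒/≤ (0<gain i) (greedy-choice i x) ⟩
          K * c ⁅ x ⁆ ∎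

      -- As `A*` is feasible, truncation gives it exactly the value `τ`, so the residual is a
      -- difference of two values of `fτ`.
      residual-≤ : ∀ i → residual i ≤ sumOver (h i) A*
      residual-≤ i = begin
        τ - fτ (A i)        ≈⟨ +-congʳ (x≤y⇒x⊓y≈x f[A*]≥τ) ⟨
        fτ A* - fτ (A i)    ≤⟨ difference-≤-marginals fτ-monotone fτ-dim (A i) A* ⟩
        sumOver (h i) A*    ∎

      h≤α : ∀ i x → h i x ≤ α
      h≤α i x = begin
        Δ fτ (A i) x  ≤⟨ ⊓-difference-≤ (f-monotone (p⊆p∪q ⁅ x ⁆)) ⟩
        Δ f (A i) x   ≤⟨ Δ-≤-singleton f-dim (f-nonNegative ⊥) (A i) x ⟩
        f ⁅ x ⁆       ≤⟨ proj₂ isα x _ ⟩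
        α             ∎

      0<β : 0# < β
      0<β = let (_ , 0<Δ , Δ≈β) , _ = isβ in
        <-≤-trans 0<Δ (≤-reflexive Δ≈β)

      β≤α : β ≤ α
      β≤α = let ((i , x) , _ , Δ≈β) , _ = isβ in
        ≤-trans (≤-reflexive (sym Δ≈β)) (h≤α i x)

      open Charging.Charges R 0<β β≤α using (L; L+1-nonNeg; cost-≤-charges)

      output-≤-charges : c output ≤ (L + 1#) * sumOver (λ x → K * c ⁅ x ⁆) A*
      output-≤-charges = cost-≤-charges A* (λ x → K * c ⁅ x ⁆) (λ i → c (A i)) residual h
        (λ x → *-nonNeg 0≤K (c-nonNegative _))
        (≤-reflexive (trans (reflexive (≡.cong c start)) c-⊥))
        residual-≤
        (λ i → sub-nonNeg⁻¹ (≤-trans (proj₁ (0<gain i)) (≤-reflexive (sym (residual-drop i)))))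
        (λ i x → fτ-dim x (A-grows i))
        (h≤α zero)
        (λ i x → proj₂ isβ (i , x))
        price
        (fromℕ k)
        -- Only `F` is known to reach `τ` at the output, so the residual there may be positive;
        -- truncation keeps it nonnegative.
        (sub-nonNeg (x⊓y≤x τ (f output)))

      sum-≤-ρ : ∀ X → sumOver (λ x → c ⁅ x ⁆) X ≤ ρ * c X
      sum-≤-ρ X with nonempty? X
      ... | yes X≠∅ = /≤⇒≤* (c-pos X≠∅) (proj₂ isρ X X≠∅)
      -- The curvature ranges over nonempty sets; for the empty set the sum is zero.
      ... | no  X=∅ rewrite Empty-unique X=∅ =
        ≤-trans (≤-reflexive (sumOver-∅ {n} (λ x → c ⁅ x ⁆))) (*-nonNeg 0≤ρ (c-nonNegative ⊥))

      output-cost : c output ≤ ρ / (1# - E) * (ln (α / β) + 2#) * c A*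
      output-cost = begin
        c output
          ≤⟨ output-≤-charges ⟩
        (L + 1#) * sumOver (λ x → K * c ⁅ x ⁆) A*
          ≈⟨ *-congˡ (sumOver-* K (λ x → c ⁅ x ⁆) A*) ⟩
        (L + 1#) * (K * sumOver (λ x → c ⁅ x ⁆) A*)
          ≤⟨ *-monoˡ-≤ L+1-nonNeg (*-monoˡ-≤ 0≤K (sum-≤-ρ A*)) ⟩
        (L + 1#) * (K * (ρ * c A*))
          ≈⟨ solve 4 (λ l K ρ a → l :* (K :* (ρ :* a)) := K :* ρ :* (l :* a))
               refl (L + 1#) K ρ (c A*) ⟩
        K * ρ * ((L + 1#) * c A*)
          ≤⟨ *-monoʳ-≤ (*-nonNeg L+1-nonNeg (c-nonNegative A*)) Kρ≤ρ/[1-E] ⟩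
        ρ / (1# - E) * ((L + 1#) * c A*)
          -- The charges yield `L + 1#`, relaxed here to the constant of the theorem.
          ≤⟨ *-monoˡ-≤ (*-nonNeg 0≤ρ (⁻¹-nonNeg 0<1-E))
               (*-monoʳ-≤ (c-nonNegative A*) L+1≤L+2) ⟩
        ρ / (1# - E) * ((L + 2#) * c A*)
          ≈⟨ *-assoc _ _ _ ⟨
        ρ / (1# - E) * (L + 2#) * c A* ∎
        where
        L+1≤L+2 : L + 1# ≤ L + 2#
        L+1≤L+2 = +-monoʳ-≤ L (≤-from-difference 0≤1
          (solve 0 (con (+ 2) :- con (+ 1) := con (+ 1)) refl))

theorem1 :
    ∀ {ℓ} (R : RealField ℓ) (n : ℕ) .{{_ : NonZero n}} →
    let open RealField R
        open Logarithm R
        open Cover R {n}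
    in
    (f c : SetFunction) (τ : ℝ) → IsSCSC f c τ →
    (A* : Subset n) → IsOptimal f c τ A* →
    (ε : ℝ) → 0# ≤ ε →
    (F : SetFunction) → NonNegative F → IsApproximate ε f F →
    (k : ℕ) (run : GreedyRun F c τ k) →
    let A = GreedyRun.output run in
    (f A ≥ τ - ε) ×
    (∀ α β μ ρ cmin cmax →
      IsMaxSingleton f α →
      IsMinPositiveMarginal run f β →
      IsMinGain run f μ →
      IsCurvature c ρ →
      IsMinSingleton c cmin →
      IsMaxSingleton c cmax →
      μ > 4# * ε * cmax * ρ / cmin →
      c A ≤ ρ / (1# - 4# * ε * cmax * ρ / (cmin * μ)) * (ln (α / β) + 2#) * c A*)
theorem1 R n f c τ scsc A* optimal ε 0≤ε F _ approx k run =
  output-feasible ,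
  λ α β μ ρ cmin cmax isα isβ isμ isρ isCmin isCmax μ> →
    output-cost (proj₁ optimal) isα isβ isμ isρ isCmin isCmax μ>
  where open Greedy.Analysis R scsc 0≤ε approx run
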